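{- There is an $\mathcal{O}(n)$ time algorithm that, given an idempotent permutation $\pi\in IP(n)$ with characteristic function defined implicitly (fixed elements negative, idle elements positive), in-place inverts the negative elements while permuting the positive elements, using $3\log n$ bits of additional space.
   Context: $[n]=\{1,\ldots,n\}$. An idempotent permutation of degree $k$ ($1\le k\le n$) is a permutation $\pi$ of $[n]$ together with a distinguished set of indices $A=\{a_1<\cdots<a_k\}\subseteq[n]$ such that the values $c_i=\pi(a_i)$ satisfy $1=c_1<c_2<\cdots<c_k$. The values $c_i$ are called the fixed elements of $\pi$ (this does not mean $\pi(c_i)=c_i$), the others idle. $IP(n)$ denotes the set of idempotent permutations of all degrees. The characteristic function of $A$ is "defined implicitly" when $\pi$ is stored in an array with fixed elements negated: the entry at $x$ is $-\pi(x)$ if $x\in A$ and $\pi(x)$ otherwise. "In-place inverting the negative elements while permuting the positive elements" (associative permuting) means transforming this array, in the same memory, into the sequence $\gamma$ in which every positive element $v$ has been moved to position $v$, and every negative element $-c_i$ at position $a_i$ has been moved to position $c_i$ and replaced by the negative $-a_i$ of its former position; i.e. $\gamma(c_i)=-a_i$ for $i=1,\ldots,k$ and $\gamma(x)=x$ for $x\in[n]\setminus\{c_1,\ldots,c_k\}$. Computation is on a unit-cost random access machine; "$3\log n$ bits" means that besides the array 3 auxiliary variables of $\log n$ bits each (indices or values of magnitude $O(n)$) are used. -}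

module Defs where

open import Data.Bool using (if_then_else_)
open import Data.Fin as Fin using (Fin; toℕ; fromℕ<)
open import Data.Fin.Permutation using (Permutation′; _⟨$⟩ʳ_)
open import Data.Fin.Properties using (any?)
open import Data.Integer as ℤ using (ℤ; +_; +[1+_]; -[1+_]; ∣_∣)
open import Data.List using (List; drop; head)
open import Data.Maybe using (Maybe; just; nothing; _>>=_; map)
open import Data.Nat as ℕ using (ℕ; suc)
open import Data.Product using (∃; ∃-syntax; _×_)
open import Data.Vec using (Vec; lookup; replicate; tabulate; _[_]≔_)
open import Data.Vec.Relation.Unary.All using (All)
open import Relation.Binary.PropositionalEquality using (_≡_)
open import Relation.Nullary using (¬_; Dec; does; yes; no)

-- The set [n] = {1, …, n} is represented by Fin n, with x : Fin n standing for
-- the number toℕ x + 1; so the least element, 1, is the x with toℕ x ≡ 0.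

⟦_⟧ : ∀ {n} → Fin n → ℤ
⟦ x ⟧ = +[1+ toℕ x ]

-- The distinguished set A = {a₁ < ⋯ < aₖ} is given by its increasing
-- enumeration a (indexed from zero).

record IdempotentPermutation (n k : ℕ) : Set where
  field
    perm  : Permutation′ n
    1≤k   : 1 ℕ.≤ k
    a     : Fin k → Fin n
    a-inc : ∀ {i j} → i Fin.< j → a i Fin.< a j

  π : Fin n → Fin n
  π x = perm ⟨$⟩ʳ x

  c : Fin k → Fin n
  c i = π (a i)

  field
    c-inc : ∀ {i j} → i Fin.< j → c i Fin.< c j
    c₁≡1  : toℕ (c (fromℕ< 1≤k)) ≡ 0

  _∈A : Fin n → Set
  x ∈A = ∃[ i ] a i ≡ x

  _∈A? : (x : Fin n) → Dec (x ∈A)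
  x ∈A? = any? (λ i → a i Fin.≟ x)

  Fixed : Fin n → Set
  Fixed x = ∃[ i ] c i ≡ x

  implicitArray : Vec ℤ n
  implicitArray = tabulate λ x → if does (x ∈A?) then ℤ.- ⟦ π x ⟧ else ⟦ π x ⟧

  -- The given array is the sequence γ.
  IsAssociativelyPermuted : Vec ℤ n → Set
  IsAssociativelyPermuted γ =
      (∀ i → lookup γ (c i) ≡ ℤ.- ⟦ a i ⟧)
    × (∀ x → ¬ Fixed x → lookup γ x ≡ ⟦ x ⟧)

IP : ℕ → Set
IP n = ∃ (IdempotentPermutation n)

-- A random access machine with r registers, working on an array of integers.
-- A program is a fixed list of instructions, hence does not depend on the
-- length of the array; the latter is available as a read-only operand.

data Location (r : ℕ) : Set where
  reg  : Fin r → Location r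
  cell : Fin r → Location r    -- the array entry whose index is in the register

data Operand (r : ℕ) : Set where
  lit : ℤ → Operand r
  len : Operand r
  val : Location r → Operand r

infix 4 _≔_ _≔_⊕_ _≔_⊖_

data Instruction (r : ℕ) : Set where
  _≔_            : Location r → Operand r → Instruction r
  _≔_⊕_ _≔_⊖_    : Location r → Operand r → Operand r → Instruction r
  goto           : ℕ → Instruction r
  if_<_goto_     : Operand r → Operand r → ℕ → Instruction r
  if_==_goto_    : Operand r → Operand r → ℕ → Instruction r
  halt           : Instruction r

Program : ℕ → Set
Program r = List (Instruction r)

record Config (r n : ℕ) : Set where
  constructor config
  field
    pc        : ℕ
    registers : Vec ℤ r
    array     : Vec ℤ n

open Config public

module _ {r n : ℕ} where

  -- Array indices run from 1 to n; any other index is a fault.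
  index : ℤ → Maybe (Fin n)
  index (+ 0)    = nothing
  index +[1+ m ] with m ℕ.<? n
  ... | yes m<n = just (fromℕ< m<n)
  ... | no  _   = nothing
  index -[1+ _ ] = nothing

  read : Config r n → Location r → Maybe ℤ
  read s (reg i)  = just (lookup (registers s) i)
  read s (cell i) = map (lookup (array s)) (index (lookup (registers s) i))

  eval : Config r n → Operand r → Maybe ℤ
  eval s (lit z) = just z
  eval s len     = just (+ n)
  eval s (val l) = read s l

  write : Config r n → Location r → ℤ → Maybe (Config r n)
  write s (reg i)  z = just record s { registers = registers s [ i ]≔ z }
  write s (cell i) z =
    map (λ x → record s { array = array s [ x ]≔ z })
        (index (lookup (registers s) i))

  jump : ℕ → Config r n → Config r n
  jump q s = record s { pc = q }

  next : Config r n → Config r n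
  next s = jump (suc (pc s)) s

  -- The result is nothing on halt and on a fault.
  execute : Instruction r → Config r n → Maybe (Config r n)
  execute (l ≔ o) s = do
    z ← eval s o
    map next (write s l z)
  execute (l ≔ o ⊕ p) s = do
    y ← eval s o
    z ← eval s p
    map next (write s l (y ℤ.+ z))
  execute (l ≔ o ⊖ p) s = do
    y ← eval s o
    z ← eval s p
    map next (write s l (y ℤ.- z))
  execute (goto q) s = just (jump q s)
  execute (if o < p goto q) s = do
    y ← eval s o
    z ← eval s p
    just (if does (y ℤ.<? z) then jump q s else next s)
  execute (if o == p goto q) s = do
    y ← eval s o
    z ← eval s p
    just (if does (y ℤ.≟ z) then jump q s else next s)
  execute halt s = nothing

  fetch : Program r → Config r n → Maybe (Instruction r)
  fetch P s = head (drop (pc s) P)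

  step : Program r → Config r n → Maybe (Config r n)
  step P s = fetch P s >>= λ I → execute I s

  -- Execution P Q s t s′: started in s, the program P reaches a halt instruction
  -- in s′ after exactly t steps, and every configuration visited, including s
  -- and s′, satisfies Q.
  data Execution (P : Program r) (Q : Config r n → Set) :
                 Config r n → ℕ → Config r n → Set where
    done : ∀ {s} → Q s → fetch P s ≡ just halt → Execution P Q s 0 s
    more : ∀ {s s′ s″ t} → Q s → step P s ≡ just s′ →
           Execution P Q s′ t s″ → Execution P Q s (suc t) s″

  initial : Vec ℤ n → Config r n
  initial xs = config 0 (replicate r (+ 0)) xs

  -- Registers hold numbers of magnitude at most d * n, that is log n + O(1)
  -- bits each.  Array entries never exceed the range ±n of the input: a larger
  -- range, even by a constant factor, would give Θ(n) bits of hidden storage.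
  InSpace : ℕ → Config r n → Set
  InSpace d s = All (λ z → ∣ z ∣ ℕ.≤ d ℕ.* n) (registers s)
              × All (λ z → ∣ z ∣ ℕ.≤ n) (array s)

{-# OPTIONS --safe #-}
module Submission where

-- The array is scanned from left to right.  When the entry at a position x is
-- positive and differs from x, the cycle of π through x is walked once around:
-- the entry taken from a position p leads to π p, where the required entry is
-- written (π p itself if p is idle, minus p if p is in A) after the old entry has
-- been taken out.  The start of the walk is marked by the entry 0, which occurs
-- nowhere else.  Reading it tells that the walk is back at its start, and this is
-- also where the scan has to resume, so that three registers suffice: the scan
-- position need not be kept during a walk.
--
-- A walk makes every positive entry of its cycle equal to its own position, so no
-- cycle is walked twice.  Hence at most n steps of walks and n + 1 steps of the
-- scan occur, each of bounded cost.
--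
-- The cycles never walked are those on which each position is in A or is a fixed
-- point of π.  By the definition of an idempotent permutation π is increasing on
-- A.  If x < π x held on such a cycle, then also π x < π (π x), and so on without
-- end, which is impossible in a finite set; likewise for x > π x.  So π is the
-- identity there (settled⇒fixpoint), and the given entry is the required one
-- (source≡target): an all-negative cycle needs no work.
--
-- For the proof, U is the set of the positions not yet overwritten by a walk.
-- Outside U the array holds the required entries, inside U the given ones, apart
-- from the mark.  The invariants Scanning and Walking state this together with
-- the closure of U under π; the lemmas advance, enter, follow and leave preserve
-- them, and scan and walk run the program by induction on a bound for the measure
-- ∣ U ∣ + (n - m), where m positions have been scanned.

open import Data.Bool using (true; false; if_then_else_)
open import Data.Fin as Fin using (Fin; zero; suc; toℕ; fromℕ<)
open import Data.Fin.Induction using (<-wellFounded; >-wellFounded)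
open import Data.Fin.Patterns using (0F; 1F; 2F)
open import Data.Fin.Permutation using (_⟨$⟩ʳ_; _⟨$⟩ˡ_; inverseˡ; inverseʳ)
open import Data.Fin.Properties as Finₚ using (toℕ<n; toℕ-fromℕ<; fromℕ<-toℕ; toℕ-injective)
open import Data.Fin.Subset using (Subset; inside; outside; _∈_; _∉_; _─_; _-_; ∣_∣; ⊤; ⁅_⁆)
open import Data.Fin.Subset.Properties
  using (_∈?_; ∈⊤; ∣⊤∣≡n; p─q⊆p; x∈⁅x⁆; x∈p∧x≢y⇒x∈p-y; x∈p⇒∣p-x∣<∣p∣)
open import Data.Integer as ℤ using (ℤ; +_)
open import Data.List using ([]; _∷_)
open import Data.Maybe using (just)
open import Data.Nat as ℕ using (ℕ; zero; suc; _≤_; _<_; _+_; _*_; z≤n; s≤s; s≤s⁻¹)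
open import Data.Nat.Properties
open import Data.Nat.Tactic.RingSolver using (solve-∀)
open import Data.Product using (Σ-syntax; ∃-syntax; _×_; _,_; proj₂)
open import Data.Sum using (_⊎_; inj₁; inj₂)
open import Data.Vec using (Vec; []; _∷_; there; lookup; _[_]≔_)
open import Data.Vec.Properties using (lookup∘tabulate; lookup∘update; lookup∘update′)
open import Data.Vec.Relation.Unary.All using (All; []; _∷_)
open import Data.Vec.Relation.Unary.All.Properties using (lookup⁺; lookup⁻)
open import Function using (_∘_; case_of_)
open import Induction.WellFounded using (Acc; acc; WellFounded)
open import Level using (0ℓ)
open import Relation.Binary.Core using (Rel)
open import Relation.Binary.Definitions using (tri<; tri≈; tri>)
open import Relation.Binary.PropositionalEquality
open import Relation.Nullary using (¬_; yes; no; does; contradiction)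
open import Relation.Nullary.Decidable using (dec-true; dec-false)
open import Defs

-- The three registers: the current position, the value taken from it, and the
-- position to which that value leads.
pattern pos  = 0F
pattern item = 1F
pattern dest = 2F

-- Jump targets are instruction numbers, shown on the right.
program : Program 3
program =
  -- Scan: go to the next position, and stay in the scan if its entry is
  -- negative or is its own position.
    (reg pos ≔ lit (+ 1) ⊕ val (reg pos))                --  0
  ∷ (if len < val (reg pos) goto 17)                     --  1
  ∷ (reg item ≔ val (cell pos))                          --  2
  ∷ (if val (reg item) < lit (+ 0) goto 0)               --  3
  ∷ (if val (reg item) == val (reg pos) goto 0)          --  4
  -- Otherwise mark the start of the cycle, and walk along it.
  ∷ (cell pos ≔ lit (+ 0))                               --  5
  ∷ (if val (reg item) < lit (+ 0) goto 11)              --  6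
  -- A positive item is exchanged with the entry at its position.
  ∷ (reg dest ≔ val (reg item))                          --  7
  ∷ (reg item ≔ val (cell dest))                         --  8
  ∷ (cell dest ≔ val (reg dest))                         --  9
  ∷ (goto 14)                                            -- 10
  -- A negative item leaves behind the negated position from which it came.
  ∷ (reg dest ≔ lit (+ 0) ⊖ val (reg item))              -- 11
  ∷ (reg item ≔ val (cell dest))                         -- 12
  ∷ (cell dest ≔ lit (+ 0) ⊖ val (reg pos))              -- 13
  -- The mark, once read, shows that the cycle is closed at the position where
  -- the scan was interrupted.
  ∷ (reg pos ≔ val (reg dest))                           -- 14
  ∷ (if val (reg item) == lit (+ 0) goto 0)              -- 15
  ∷ (goto 6)                                             -- 16
  ∷ halt                                                 -- 17
  ∷ []

-- Subsets, arrays and encoded positions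

x∈p─q⇒x∉q : ∀ {n} {x : Fin n} (p q : Subset n) → x ∈ p ─ q → x ∉ q
x∈p─q⇒x∉q (_ ∷ p) (outside ∷ q) (there x∈) (there x∈q) = x∈p─q⇒x∉q p q x∈ x∈q
x∈p─q⇒x∉q (_ ∷ p) (inside  ∷ q) (there x∈) (there x∈q) = x∈p─q⇒x∉q p q x∈ x∈q

x∈p-y⇒x≢y : ∀ {n} {x y : Fin n} (p : Subset n) → x ∈ p - y → x ≢ y
x∈p-y⇒x≢y {y = y} p x∈ refl = x∈p─q⇒x∉q p ⁅ y ⁆ x∈ (x∈⁅x⁆ y)

All-[]≔ : ∀ {A : Set} {P : A → Set} {n} {xs : Vec A n} {z} (i : Fin n) →
          All P xs → P z → All P (xs [ i ]≔ z)
All-[]≔ zero    (_ ∷ ps) p  = p ∷ ps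
All-[]≔ (suc i) (p ∷ ps) p′ = p ∷ All-[]≔ i ps p′

-- Removing an element from the set pays for one unit of the measure that
-- bounds the running time.
removal-lowers : ∀ {n} {U : Subset n} {x l m} μ → x ∈ U →
                 ∣ U ∣ + l ≤ suc μ + m → ∣ U - x ∣ + l ≤ μ + m
removal-lowers {l = l} _ x∈U bound =
  s≤s⁻¹ (≤-trans (+-monoˡ-≤ l (x∈p⇒∣p-x∣<∣p∣ x∈U)) bound)

index-⟦⟧ : ∀ {r n} (x : Fin n) → index {r} {n} ⟦ x ⟧ ≡ just x
index-⟦⟧ {n = n} x with toℕ x ℕ.<? n
... | yes x<n = cong just (fromℕ<-toℕ x x<n)
... | no  x≮n = contradiction (toℕ<n x) x≮n

⟦⟧-≟ : ∀ {n} {x y : Fin n} → x ≢ y → does (⟦ x ⟧ ℤ.≟ ⟦ y ⟧) ≡ false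
⟦⟧-≟ {x = x} {y} x≢y =
  dec-false (⟦ x ⟧ ℤ.≟ ⟦ y ⟧) λ { eq → x≢y (toℕ-injective (suc-injective (cong ℤ.∣_∣ eq))) }

-- The given and the required entries

module _ {n k} (ip : IdempotentPermutation n k) where
  open IdempotentPermutation ip

  π-injective : ∀ {x y} → π x ≡ π y → x ≡ y
  π-injective eq =
    trans (sym (inverseˡ perm)) (trans (cong (perm ⟨$⟩ˡ_) eq) (inverseˡ perm))

  1≤n : 1 ≤ n
  1≤n = ≤-trans (s≤s z≤n) (toℕ<n (a (fromℕ< 1≤k)))

  -- The given entry at position x.
  source : Fin n → ℤ
  source x = if does (x ∈A?) then ℤ.- ⟦ π x ⟧ else ⟦ π x ⟧

  -- The entry required at position π x.  As π is onto, this describes the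
  -- whole sequence γ, without the inverse of π.
  target : Fin n → ℤ
  target x = if does (x ∈A?) then ℤ.- ⟦ x ⟧ else ⟦ π x ⟧

  source-fixed : ∀ {x} → x ∈A → source x ≡ ℤ.- ⟦ π x ⟧
  source-fixed {x} x∈A rewrite dec-true (x ∈A?) x∈A = refl

  source-idle : ∀ {x} → ¬ x ∈A → source x ≡ ⟦ π x ⟧
  source-idle {x} x∉A rewrite dec-false (x ∈A?) x∉A = refl

  target-fixed : ∀ {x} → x ∈A → target x ≡ ℤ.- ⟦ x ⟧
  target-fixed {x} x∈A rewrite dec-true (x ∈A?) x∈A = refl

  target-idle : ∀ {x} → ¬ x ∈A → target x ≡ ⟦ π x ⟧
  target-idle {x} x∉A rewrite dec-false (x ∈A?) x∉A = refl

  -- The array is γ.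
  Placed : Vec ℤ n → Set
  Placed xs = ∀ x → lookup xs (π x) ≡ target x

  placed⇒associativelyPermuted : ∀ xs → Placed xs → IsAssociativelyPermuted xs
  placed⇒associativelyPermuted xs placed = fixed , idle
    where
    fixed : ∀ i → lookup xs (c i) ≡ ℤ.- ⟦ a i ⟧
    fixed i = trans (placed (a i)) (target-fixed (i , refl))

    idle : ∀ x → ¬ Fixed x → lookup xs x ≡ ⟦ x ⟧
    idle x x∉C =
      subst (λ y → lookup xs y ≡ ⟦ y ⟧) (inverseʳ perm)
        (trans (placed (perm ⟨$⟩ˡ x))
               (target-idle λ (i , aᵢ≡) → x∉C (i , trans (cong π aᵢ≡) (inverseʳ perm))))

  -- Settled cycles

  π-mono-A : ∀ {x y} → x ∈A → y ∈A → x Fin.< y → π x Fin.< π y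
  π-mono-A (i , refl) (j , refl) aᵢ<aⱼ with Finₚ.<-cmp i j
  ... | tri< i<j _    _   = c-inc i<j
  ... | tri≈ _   refl _   = contradiction aᵢ<aⱼ (<-irrefl refl)
  ... | tri> _   _    j<i = contradiction aᵢ<aⱼ (<-asym (a-inc j<i))

  -- The scan leaves such a position alone.
  Settled : Fin n → Set
  Settled x = x ∈A ⊎ π x ≡ x

  -- On a set that is closed under π and has only settled elements, π is the
  -- identity.
  module _ {U : Subset n}
           (closed  : ∀ {x} → x ∈ U → π x ∈ U)
           (settled : ∀ {x} → x ∈ U → Settled x) where

    -- One step of π downwards in a well-founded order forces the next one, by
    -- monotonicity on A, and so an infinite descent.
    no-chain : {_⊏_ : Rel (Fin n) 0ℓ} → WellFounded _⊏_ →
               (∀ {x y} → x ∈A → y ∈A → x ⊏ y → π x ⊏ π y) →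
               ∀ {x} → x ∈ U → ¬ π x ⊏ x
    no-chain {_⊏_} wf mono {x} = go (wf x)
      where
      π² : ∀ {x} → x ∈ U → π x ⊏ x → π (π x) ⊏ π x
      π² x∈U πx⊏x with settled x∈U | settled (closed x∈U)
      ... | inj₁ x∈A  | inj₁ πx∈A   = mono πx∈A x∈A πx⊏x
      ... | inj₂ πx≡x | _           = subst (λ y → π y ⊏ y) (sym πx≡x) πx⊏x
      ... | inj₁ _    | inj₂ ππx≡πx =
        subst (λ y → π y ⊏ y) (sym (π-injective ππx≡πx)) πx⊏x

      go : ∀ {x} → Acc _⊏_ x → x ∈ U → ¬ π x ⊏ x
      go (acc rs) x∈U πx⊏x = go (rs πx⊏x) (closed x∈U) (π² x∈U πx⊏x)

    settled⇒fixpoint : ∀ {x} → x ∈ U → π x ≡ x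
    settled⇒fixpoint {x} x∈U with Finₚ.<-cmp (π x) x
    ... | tri< πx<x _ _ = contradiction πx<x (no-chain <-wellFounded π-mono-A x∈U)
    ... | tri≈ _ πx≡x _ = πx≡x
    ... | tri> _ _ x<πx =
      contradiction x<πx (no-chain >-wellFounded (λ x∈A y∈A → π-mono-A y∈A x∈A) x∈U)

  source≡target : ∀ {x} → π x ≡ x → source x ≡ target x
  source≡target {x} πx≡x with does (x ∈A?)
  ... | true  = cong (λ y → ℤ.- ⟦ y ⟧) πx≡x
  ... | false = refl

  -- Machine configurations and the space bound

  -- The configuration at instruction l, with x, y, z in pos, item, dest.
  at : ℕ → ℤ → ℤ → ℤ → Vec ℤ n → Config 3 n
  at l x y z xs = config l (x ∷ y ∷ z ∷ []) xs

  -- The space bounds on a register, with d = 2 since the scan ends with n + 1 in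
  -- the position register, and on the array.
  Small : ℤ → Set
  Small z = ℤ.∣ z ∣ ≤ 2 * n

  Bounded : Vec ℤ n → Set
  Bounded = All (λ z → ℤ.∣ z ∣ ≤ n)

  -- The program counter does not take part in the space bound, so 0 stands for
  -- any value of it.
  space : ∀ {x y z xs} → Small x → Small y → Small z → Bounded xs →
          InSpace 2 (at 0 x y z xs)
  space sx sy sz bxs = sx ∷ sy ∷ sz ∷ [] , bxs

  ≤n⇒small : ∀ {m} → m ≤ n → m ≤ 2 * n
  ≤n⇒small m≤n = ≤-trans m≤n (m≤m+n n _)

  ⟦_⟧-small : ∀ x → Small ⟦ x ⟧
  ⟦ x ⟧-small = ≤n⇒small (toℕ<n x)

  source-bounded : ∀ x → ℤ.∣ source x ∣ ≤ n
  source-bounded x with does (x ∈A?)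
  ... | true  = toℕ<n (π x)
  ... | false = toℕ<n (π x)

  target-bounded : ∀ x → ℤ.∣ target x ∣ ≤ n
  target-bounded x with does (x ∈A?)
  ... | true  = toℕ<n x
  ... | false = toℕ<n (π x)

  lookup-small : ∀ {xs} → Bounded xs → ∀ x → Small (lookup xs x)
  lookup-small bxs x = ≤n⇒small (lookup⁺ bxs x)

  -- Within b steps from s the program halts, in bounded space, with the array γ.
  Success : ℕ → Config 3 n → Set
  Success b s = Σ[ t ∈ ℕ ] Σ[ s′ ∈ Config 3 n ]
    (t ≤ b × Execution program (InSpace 2) s t s′ × IsAssociativelyPermuted (array s′))

  one-step : ∀ {b s s′} → InSpace 2 s → step program s ≡ just s′ →
             Success b s′ → Success (suc b) s
  one-step q eq (t , s″ , t≤b , ex , ok) =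
    suc t , s″ , s≤s t≤b , more q eq ex , ok

  relax : ∀ {b b′ s} → b ≤ b′ → Success b s → Success b′ s
  relax b≤b′ (t , s′ , t≤b , rest) = t , s′ , ≤-trans t≤b b≤b′ , rest

  -- Invariants

  -- The invariant of the scan, where the first m positions have been scanned and
  -- U is the set of the positions not yet overwritten by a walk.
  record Scanning (m : ℕ) (U : Subset n) (xs : Vec ℤ n) : Set where
    field
      bounded   : Bounded xs
      closed    : ∀ {x} → x ∈ U → π x ∈ U
      settled   : ∀ {x} → toℕ x < m → x ∈ U → Settled x
      processed : ∀ {x} → π x ∉ U → lookup xs (π x) ≡ target x
      untouched : ∀ {x} → x ∈ U → lookup xs x ≡ source x

  -- The invariant of a walk that began at i and has reached p: the entry of p has
  -- been taken into a register and is to be dealt with at π p.  The position i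
  -- stays in U until the walk returns to it, but holds the mark 0.
  record Walking (i p : Fin n) (U : Subset n) (xs : Vec ℤ n) : Set where
    field
      bounded   : Bounded xs
      closed    : ∀ {x} → x ∈ U → x ≢ i → π x ∈ U
      start     : i ∈ U
      ahead     : π p ∈ U
      -- At the beginning p is i itself; later p has been overwritten.
      behind    : p ∈ U → p ≡ i
      settled   : ∀ {x} → toℕ x < toℕ i → x ∈ U → Settled x
      processed : ∀ {x} → π x ∉ U → lookup xs (π x) ≡ target x
      untouched : ∀ {x} → x ∈ U → x ≢ i → lookup xs x ≡ source x
      mark      : lookup xs i ≡ + 0

  advance : ∀ {x U xs} → Scanning (toℕ x) U xs → (x ∈ U → Settled x) →
            Scanning (suc (toℕ x)) U xs
  advance {x} {U} S s = record
    { bounded = bounded ; closed = closed ; processed = processed ; untouched = untouched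
    ; settled = settled′ }
    where
    open Scanning S
    settled′ : ∀ {y} → toℕ y < suc (toℕ x) → y ∈ U → Settled y
    settled′ {y} y<1+x y∈U with y Fin.≟ x
    ... | yes refl = s y∈U
    ... | no  y≢x  = settled (≤∧≢⇒< (s≤s⁻¹ y<1+x) (y≢x ∘ toℕ-injective)) y∈U

  -- Beginning a walk.
  enter : ∀ {x U xs} → Scanning (toℕ x) U xs → x ∈ U →
          Walking x x U (xs [ x ]≔ + 0)
  enter {x} {U} {xs} S x∈U = record
    { bounded   = All-[]≔ x bounded z≤n
    ; closed    = λ y∈U _ → closed y∈U
    ; start     = x∈U
    ; ahead     = closed x∈U
    ; behind    = λ _ → refl
    ; settled   = settled
    ; processed = λ {y} πy∉U →
        trans (lookup∘update′ (λ { refl → πy∉U x∈U }) xs _) (processed πy∉U)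
    ; untouched = λ y∈U y≢x → trans (lookup∘update′ y≢x xs _) (untouched y∈U)
    ; mark      = lookup∘update x xs _
    }
    where open Scanning S

  module _ {i p U xs} (W : Walking i p U xs) where
    open Walking W

    private
      xs′ : Vec ℤ n
      xs′ = xs [ π p ]≔ target p

      U⁻ : ∀ {x} → x ∈ U - π p → x ∈ U
      U⁻ = p─q⊆p U _

      bounded′ : Bounded xs′
      bounded′ = All-[]≔ (π p) bounded (target-bounded p)

      processed′ : ∀ {x} → π x ∉ U - π p → lookup xs′ (π x) ≡ target x
      processed′ {x} πx∉U′ with x Fin.≟ p
      ... | yes refl = lookup∘update (π p) xs _
      ... | no  x≢p  =
        trans (lookup∘update′ (x≢p ∘ π-injective) xs _)
              (processed λ πx∈U → πx∉U′ (x∈p∧x≢y⇒x∈p-y πx∈U (x≢p ∘ π-injective)))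

      untouched′ : ∀ {x} → x ∈ U - π p → x ≢ i → lookup xs′ x ≡ source x
      untouched′ x∈U′ x≢i =
        trans (lookup∘update′ (x∈p-y⇒x≢y U x∈U′) xs _) (untouched (U⁻ x∈U′) x≢i)

      closed′ : ∀ {x} → x ∈ U → x ≢ i → π x ∈ U - π p
      closed′ x∈U x≢i = x∈p∧x≢y⇒x∈p-y (closed x∈U x≢i) λ eq →
        case π-injective eq of λ { refl → x≢i (behind x∈U) }

    -- Writing at π p ends the walk if π p is its start.
    leave : π p ≡ i → Scanning (suc (toℕ i)) (U - π p) xs′
    leave refl = record
      { bounded   = bounded′
      ; closed    = λ x∈U′ → closed′ (U⁻ x∈U′) (x∈p-y⇒x≢y U x∈U′)
      ; settled   = λ {x} x<1+i x∈U′ →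
          settled (≤∧≢⇒< (s≤s⁻¹ x<1+i) (x∈p-y⇒x≢y U x∈U′ ∘ toℕ-injective)) (U⁻ x∈U′)
      ; processed = processed′
      ; untouched = λ x∈U′ → untouched′ x∈U′ (x∈p-y⇒x≢y U x∈U′)
      }

    -- Writing at any other π p continues the walk from there.
    follow : π p ≢ i → Walking i (π p) (U - π p) xs′
    follow πp≢i = record
      { bounded   = bounded′
      ; closed    = λ x∈U′ x≢i → closed′ (U⁻ x∈U′) x≢i
      ; start     = x∈p∧x≢y⇒x∈p-y start (≢-sym πp≢i)
      ; ahead     = closed′ ahead πp≢i
      ; behind    = λ πp∈U′ → contradiction refl (x∈p-y⇒x≢y U πp∈U′)
      ; settled   = λ x<i x∈U′ → settled x<i (U⁻ x∈U′)
      ; processed = processed′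
      ; untouched = untouched′
      ; mark      = trans (lookup∘update′ (≢-sym πp≢i) xs _) mark
      }

  scan-start : Scanning 0 ⊤ implicitArray
  scan-start = record
    { bounded   = lookup⁻ λ x → subst (λ z → ℤ.∣ z ∣ ≤ n) (sym (initially x)) (source-bounded x)
    ; closed    = λ _ → ∈⊤
    ; settled   = λ ()
    ; processed = λ πx∉⊤ → contradiction ∈⊤ πx∉⊤
    ; untouched = λ {x} _ → initially x
    }
    where
    initially : ∀ x → lookup implicitArray x ≡ source x
    initially = lookup∘tabulate source

  scan-end : ∀ {U xs} → Scanning n U xs → Placed xs
  scan-end {U} {xs} S x with π x ∈? U
  ... | no  πx∉U = processed πx∉U
    where open Scanning S
  ... | yes πx∈U =
    subst (λ y → lookup xs y ≡ target x) (sym πx≡x)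
      (trans (untouched (subst (_∈ U) πx≡x πx∈U)) (source≡target πx≡x))
    where
    open Scanning S
    πx≡x : π x ≡ x
    πx≡x = π-injective (settled⇒fixpoint closed (settled (toℕ<n _)) πx∈U)

  -- Execution of the program

  scan-halt : ∀ {b v w U xs} → Scanning n U xs → Small v → Small w →
              Success (2 + b) (at 0 (+ n) v w xs)
  scan-halt {v = v} {w} {U} {xs} S sv sw =
    one-step (space (≤n⇒small ≤-refl) sv sw bounded) refl
    (one-step (space 1+n-small sv sw bounded) overflow
    (0 , _ , z≤n , done (space 1+n-small sv sw bounded) refl ,
     placed⇒associativelyPermuted xs (scan-end S)))
    where
    open Scanning S
    1+n-small : suc n ≤ 2 * n
    1+n-small = +-mono-≤ 1≤n (m≤m+n n 0)

    overflow : step program (at 1 (+ suc n) v w xs) ≡ just (at 17 (+ suc n) v w xs)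
    overflow rewrite dec-true (n ℕ.<? suc n) ≤-refl = refl

  -- The three outcomes of scanning the position x.
  module _ {x : Fin n} {U xs v w} (S : Scanning (toℕ x) U xs) (sv : Small v) (sw : Small w) where
    open Scanning S

    private
      load : ∀ {b y} → lookup xs x ≡ y → Small y →
             Success b (at 3 ⟦ x ⟧ y w xs) → Success (3 + b) (at 0 (+ toℕ x) v w xs)
      load refl sy =
        one-step (space (≤n⇒small (<⇒≤ (toℕ<n x))) sv sw bounded) refl
        ∘ one-step (space ⟦ x ⟧-small sv sw bounded) no-overflow
        ∘ one-step (space ⟦ x ⟧-small sv sw bounded) fetched
        where
        no-overflow : step program (at 1 ⟦ x ⟧ v w xs) ≡ just (at 2 ⟦ x ⟧ v w xs)
        no-overflow rewrite dec-false (n ℕ.<? suc (toℕ x)) (≤⇒≯ (toℕ<n x)) = refl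

        fetched : step program (at 2 ⟦ x ⟧ v w xs) ≡ just (at 3 ⟦ x ⟧ (lookup xs x) w xs)
        fetched rewrite index-⟦⟧ {3} x = refl

    skip-negative : ∀ {b y} → lookup xs x ≡ ℤ.- ⟦ y ⟧ →
                    Success b (at 0 ⟦ x ⟧ (ℤ.- ⟦ y ⟧) w xs) →
                    Success (4 + b) (at 0 (+ toℕ x) v w xs)
    skip-negative {y = y} eq =
      load eq ⟦ y ⟧-small ∘ one-step (space ⟦ x ⟧-small ⟦ y ⟧-small sw bounded) refl

    skip-home : ∀ {b} → lookup xs x ≡ ⟦ x ⟧ →
                Success b (at 0 ⟦ x ⟧ ⟦ x ⟧ w xs) →
                Success (5 + b) (at 0 (+ toℕ x) v w xs)
    skip-home eq =
      load eq ⟦ x ⟧-small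
      ∘ one-step (space ⟦ x ⟧-small ⟦ x ⟧-small sw bounded) refl
      ∘ one-step (space ⟦ x ⟧-small ⟦ x ⟧-small sw bounded) home
      where
      home : step program (at 4 ⟦ x ⟧ ⟦ x ⟧ w xs) ≡ just (at 0 ⟦ x ⟧ ⟦ x ⟧ w xs)
      home rewrite dec-true (⟦ x ⟧ ℤ.≟ ⟦ x ⟧) refl = refl

    open-cycle : ∀ {b y} → lookup xs x ≡ ⟦ y ⟧ → y ≢ x →
                 Success b (at 6 ⟦ x ⟧ ⟦ y ⟧ w (xs [ x ]≔ + 0)) →
                 Success (6 + b) (at 0 (+ toℕ x) v w xs)
    open-cycle {y = y} eq y≢x =
      load eq ⟦ y ⟧-small
      ∘ one-step (space ⟦ x ⟧-small ⟦ y ⟧-small sw bounded) refl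
      ∘ one-step (space ⟦ x ⟧-small ⟦ y ⟧-small sw bounded) away
      ∘ one-step (space ⟦ x ⟧-small ⟦ y ⟧-small sw bounded) marked
      where
      away : step program (at 4 ⟦ x ⟧ ⟦ y ⟧ w xs) ≡ just (at 5 ⟦ x ⟧ ⟦ y ⟧ w xs)
      away rewrite ⟦⟧-≟ y≢x = refl

      marked : step program (at 5 ⟦ x ⟧ ⟦ y ⟧ w xs) ≡
               just (at 6 ⟦ x ⟧ ⟦ y ⟧ w (xs [ x ]≔ + 0))
      marked rewrite index-⟦⟧ {3} x = refl

  module _ {p q : Fin n} {xs w} (bxs : Bounded xs) (sw : Small w) where

    private
      y = lookup xs q

      sy : Small y
      sy = lookup-small bxs q

    invert : ∀ {b} → Success b (at 15 ⟦ q ⟧ y ⟦ q ⟧ (xs [ q ]≔ ℤ.- ⟦ p ⟧)) →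
             Success (5 + b) (at 6 ⟦ p ⟧ (ℤ.- ⟦ q ⟧) w xs)
    invert =
      one-step (space ⟦ p ⟧-small ⟦ q ⟧-small sw bxs) refl
      ∘ one-step (space ⟦ p ⟧-small ⟦ q ⟧-small sw bxs) refl
      ∘ one-step (space ⟦ p ⟧-small ⟦ q ⟧-small ⟦ q ⟧-small bxs) loaded
      ∘ one-step (space ⟦ p ⟧-small sy ⟦ q ⟧-small bxs) stored
      ∘ one-step (space ⟦ p ⟧-small sy ⟦ q ⟧-small (All-[]≔ q bxs (toℕ<n p))) refl
      where
      loaded : step program (at 12 ⟦ p ⟧ (ℤ.- ⟦ q ⟧) ⟦ q ⟧ xs) ≡ just (at 13 ⟦ p ⟧ y ⟦ q ⟧ xs)
      loaded rewrite index-⟦⟧ {3} q = refl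

      stored : step program (at 13 ⟦ p ⟧ y ⟦ q ⟧ xs) ≡
               just (at 14 ⟦ p ⟧ y ⟦ q ⟧ (xs [ q ]≔ ℤ.- ⟦ p ⟧))
      stored rewrite index-⟦⟧ {3} q = refl

    permute : ∀ {b} → Success b (at 15 ⟦ q ⟧ y ⟦ q ⟧ (xs [ q ]≔ ⟦ q ⟧)) →
              Success (6 + b) (at 6 ⟦ p ⟧ ⟦ q ⟧ w xs)
    permute =
      one-step (space ⟦ p ⟧-small ⟦ q ⟧-small sw bxs) refl
      ∘ one-step (space ⟦ p ⟧-small ⟦ q ⟧-small sw bxs) refl
      ∘ one-step (space ⟦ p ⟧-small ⟦ q ⟧-small ⟦ q ⟧-small bxs) loaded
      ∘ one-step (space ⟦ p ⟧-small sy ⟦ q ⟧-small bxs) stored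
      ∘ one-step (space ⟦ p ⟧-small sy ⟦ q ⟧-small (All-[]≔ q bxs (toℕ<n q))) refl
      ∘ one-step (space ⟦ p ⟧-small sy ⟦ q ⟧-small (All-[]≔ q bxs (toℕ<n q))) refl
      where
      loaded : step program (at 8 ⟦ p ⟧ ⟦ q ⟧ ⟦ q ⟧ xs) ≡ just (at 9 ⟦ p ⟧ y ⟦ q ⟧ xs)
      loaded rewrite index-⟦⟧ {3} q = refl

      stored : step program (at 9 ⟦ p ⟧ y ⟦ q ⟧ xs) ≡
               just (at 10 ⟦ p ⟧ y ⟦ q ⟧ (xs [ q ]≔ ⟦ q ⟧))
      stored rewrite index-⟦⟧ {3} q = refl

  -- One step of a walk, up to the test for its end.
  place : ∀ {p xs v w b} → Bounded xs → Small w → v ≡ source p →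
          Success b (at 15 ⟦ π p ⟧ (lookup xs (π p)) ⟦ π p ⟧ (xs [ π p ]≔ target p)) →
          Success (6 + b) (at 6 ⟦ p ⟧ v w xs)
  place {p} {b = b} bxs sw refl rest with does (p ∈A?)
  ... | true  = relax (n≤1+n (5 + b)) (invert bxs sw rest)
  ... | false = permute bxs sw rest

  module _ {i p : Fin n} {U xs} (W : Walking i p U xs) where
    open Walking W

    private
      q   = π p
      y   = lookup xs q
      xs′ = xs [ q ]≔ target p

      sy : Small y
      sy = lookup-small bounded q

      bounded′ : Bounded xs′
      bounded′ = All-[]≔ q bounded (target-bounded p)

    close-cycle : ∀ {b} → q ≡ i → Success b (at 0 ⟦ i ⟧ (+ 0) ⟦ i ⟧ xs′) →
                  Success (1 + b) (at 15 ⟦ q ⟧ y ⟦ q ⟧ xs′)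
    close-cycle refl rewrite mark =
      one-step (space ⟦ i ⟧-small z≤n ⟦ i ⟧-small bounded′) refl

    continue : ∀ {b} → q ≢ i → Success b (at 6 ⟦ q ⟧ y ⟦ q ⟧ xs′) →
               Success (2 + b) (at 15 ⟦ q ⟧ y ⟦ q ⟧ xs′)
    continue q≢i =
      one-step (space ⟦ q ⟧-small sy ⟦ q ⟧-small bounded′) nonzero
      ∘ one-step (space ⟦ q ⟧-small sy ⟦ q ⟧-small bounded′) refl
      where
      -- Given entries are never 0, so they are not taken for the mark.
      nonzero : step program (at 15 ⟦ q ⟧ y ⟦ q ⟧ xs′) ≡ just (at 16 ⟦ q ⟧ y ⟦ q ⟧ xs′)
      nonzero rewrite untouched ahead q≢i with does (q ∈A?)
      ... | true  = refl
      ... | false = refl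

  -- Running time

  -- A unit of the measure below is worth 8 instructions, the most that a step of
  -- a walk takes (a step of the scan takes at most 6); the end of the scan takes 2 more.
  budget : ℕ → ℕ
  budget μ = μ * 8 + 2

  -- The measure is the number of positions not yet overwritten plus the number of
  -- positions not yet scanned, ∣ U ∣ + (n - m); it is bounded by μ.  A walk that
  -- began at i will return to the scan with m = i + 1.
  scan : ∀ μ {m U v w xs} → ∣ U ∣ + n ≤ μ + m → m ≤ n → Scanning m U xs →
         Small v → Small w → Success (budget μ) (at 0 (+ m) v w xs)
  scan-at : ∀ μ x {m U v w xs} → toℕ x ≡ m → ∣ U ∣ + n ≤ μ + m → Scanning m U xs →
            Small v → Small w → Success (budget μ) (at 0 (+ m) v w xs)
  walk : ∀ μ {i p U v w xs} → ∣ U ∣ + n ≤ μ + suc (toℕ i) → Walking i p U xs →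
         v ≡ source p → Small w → Success (budget μ) (at 6 ⟦ p ⟧ v w xs)

  scan μ {m} bound m≤n S sv sw with m ℕ.<? n
  ... | yes m<n = scan-at μ (fromℕ< m<n) (toℕ-fromℕ< m<n) bound S sv sw
  ... | no  m≮n with refl ← ≤-antisym m≤n (≮⇒≥ m≮n) =
    relax (m≤n+m 2 (μ * 8)) (scan-halt {0} S sv sw)

  scan-at zero x {U = U} refl bound _ _ _ =
    contradiction (≤-trans (m≤n+m n ∣ U ∣) bound) (<⇒≱ (toℕ<n x))
  scan-at (suc μ) x {U = U} {xs = xs} refl bound S sv sw = result
    where
    open Scanning S
    bound′ : ∣ U ∣ + n ≤ μ + suc (toℕ x)
    bound′ = ≤-trans bound (≤-reflexive (sym (+-suc μ (toℕ x))))

    skip-negative′ : ∀ {y} → lookup xs x ≡ ℤ.- ⟦ y ⟧ → (x ∈ U → Settled x) → _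
    skip-negative′ {y} eq s =
      relax (m≤n+m _ 4) (skip-negative S sv sw eq
        (scan μ bound′ (toℕ<n x) (advance S s) ⟦ y ⟧-small sw))

    skip-home′ : lookup xs x ≡ ⟦ x ⟧ → (x ∈ U → Settled x) → _
    skip-home′ eq s =
      relax (m≤n+m _ 3) (skip-home S sv sw eq
        (scan μ bound′ (toℕ<n x) (advance S s) ⟦ x ⟧-small sw))

    result : Success (budget (suc μ)) (at 0 (+ toℕ x) _ _ xs)
    result with x ∈? U
    ... | yes x∈U with x ∈A? | π x Fin.≟ x
    ...   | yes x∈A | _ =
      skip-negative′ (trans (untouched x∈U) (source-fixed x∈A)) λ _ → inj₁ x∈A
    ...   | no x∉A | yes πx≡x =
      skip-home′ (trans (untouched x∈U) (trans (source-idle x∉A) (cong ⟦_⟧ πx≡x)))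
                 λ _ → inj₂ πx≡x
    ...   | no x∉A | no πx≢x =
      relax (m≤n+m _ 2) (open-cycle S sv sw (trans (untouched x∈U) (source-idle x∉A)) πx≢x
        (walk μ bound′ (enter S x∈U) (sym (source-idle x∉A)) sw))
    result | no x∉U = done-at (perm ⟨$⟩ˡ x) (inverseʳ perm)
      where
      -- An overwritten position holds a required entry, never one that starts a
      -- walk.
      done-at : ∀ z → π z ≡ x → _
      done-at z refl with z ∈A?
      ... | yes z∈A =
        skip-negative′ (trans (processed x∉U) (target-fixed z∈A)) λ x∈U → contradiction x∈U x∉U
      ... | no  z∉A =
        skip-home′ (trans (processed x∉U) (target-idle z∉A)) λ x∈U → contradiction x∈U x∉U

  walk zero {i} {p} {U} bound W _ _ =
    contradiction (≤-trans (+-monoˡ-≤ n 1≤∣U∣) bound) (<⇒≱ (s≤s (toℕ<n i)))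
    where
    1≤∣U∣ : 1 ≤ ∣ U ∣
    1≤∣U∣ = ≤-trans (s≤s z≤n) (x∈p⇒∣p-x∣<∣p∣ (Walking.start W))
  walk (suc μ) {i} {p} {U} bound W eq sw with π p Fin.≟ i
  ... | yes πp≡i =
    relax (n≤1+n _) (place bounded sw eq (close-cycle W πp≡i
      (scan μ (removal-lowers μ ahead bound) (toℕ<n i) (leave W πp≡i) z≤n ⟦ i ⟧-small)))
    where open Walking W
  ... | no  πp≢i =
    place bounded sw eq (continue W πp≢i
      (walk μ (removal-lowers μ ahead bound) (follow W πp≢i) (untouched ahead πp≢i) ⟦ π p ⟧-small))
    where open Walking W

theorem3p22 : Σ[ P ∈ Program 3 ] ∃[ C ] ∃[ d ]
    ((n : ℕ) (p : IP n) →
    let open IdempotentPermutation (proj₂ p) in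
    Σ[ t ∈ ℕ ] Σ[ s ∈ Config 3 n ]
    ( t ≤ C * n
    × Execution P (InSpace d) (initial implicitArray) t s
    × IsAssociativelyPermuted (array s) ))
theorem3p22 = program , 18 , 2 , λ { n (k , ip) →
  let t , s , t≤b , run , placed =
        scan ip (n + n) (initial-bound n) z≤n (scan-start ip) z≤n z≤n
  in  t , s , ≤-trans t≤b (linear (1≤n ip)) , run , placed }
  where
  initial-bound : ∀ n → ∣ ⊤ {n} ∣ + n ≤ n + n + 0
  initial-bound n = ≤-reflexive (trans (cong (_+ n) (∣⊤∣≡n n)) (sym (+-identityʳ (n + n))))

  linear : ∀ {n} → 1 ≤ n → (n + n) * 8 + 2 ≤ 18 * n
  linear {n} 1≤n = ≤-trans (+-monoʳ-≤ ((n + n) * 8) (*-monoʳ-≤ 2 1≤n)) (≤-reflexive (collect n))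
    where
    collect : ∀ n → (n + n) * 8 + 2 * n ≡ 18 * n
    collect = solve-∀
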